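{- (smn-Theorem) Let $A\subseteq\omega$ be an infinite c.e. set, $m,n\ge1$, let $\theta^{(n)}$ be a numbering of $\mathcal S^{(n)}_A$ satisfying condition (QGN II) and let $\theta^{(m+n)}$ be a numbering of $\mathcal S^{(m+n)}_A$ satisfying condition (QGN I). Then there is a function $s\in\mathcal R^{(m+1)}$ such that for all $i\in\omega$, $\vec y\in\omega^m$, $\vec x\in\omega^n$, $$\theta^{(n)}_{s(i,\vec y)}(\vec x)=\theta^{(m+n)}_i(\vec y,\vec x)$$ (equality of partial values).
   Context: $\omega$ is the set of natural numbers; $\mathcal R^{(n)}$ is the set of total computable functions $\omega^n\to\omega$. $\langle\cdot,\cdot\rangle:\omega^2\to\omega$ is a computable bijection with $\langle x,y\rangle\ge x,y$, extended by $\langle x\rangle=x$, $\langle x_1,\dots,x_{n+1}\rangle=\langle x_1,\langle x_2,\dots,x_{n+1}\rangle\rangle$. $\mathrm{Anf}^{(n)}_A$ is the set of partial functions from $\omega^n$ to $\omega$ whose domain is either empty or equal to $\{0,\dots,a-1\}^n$ for some $a\in A$, and $\mathcal S^{(n)}_A=\mathcal R^{(n)}\cup\mathrm{Anf}^{(n)}_A$. A numbering of a set $X$ is a surjection $\omega\to X$. The extended graph of an $n$-ary partial function $q$ is $\{\langle\langle\vec y\rangle,0\rangle:\vec y\in\omega^n\}\cup\{\langle\langle\vec x\rangle,q(\vec x)+1\rangle:\vec x\in\mathrm{dom}(q)\}$. For a numbering $\theta$ of $\mathcal S^{(n)}_A$: (QGN I) means that the extended graph of $(i,\vec x)\mapsto\theta_i(\vec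 x)$ is the range of a function in $\mathcal R^{(1)}$; (QGN II) means that for every $k\in\mathcal R^{(2)}$ there is $v\in\mathcal R^{(1)}$ such that for all $i\in\omega$, $r\in\mathcal S^{(n)}_A$: if $\{k(i,t):t\in\omega\}$ is the extended graph of $r$, then $r=\theta_{v(i)}$. -}

module Defs where

open import Data.Fin.Base using (Fin)
open import Data.Nat.Base using (ℕ; zero; suc; _≤_; _<_)
open import Data.Product.Base using (∃; ∃-syntax; _×_; uncurry)
open import Data.Vec.Base using (Vec; []; _∷_; head; tail; lookup)
open import Data.Vec.N-ary using (_$ⁿ_)
open import Data.Vec.Relation.Binary.Pointwise.Inductive using (Pointwise)
open import Data.Vec.Relation.Unary.All using (All)
open import Function.Definitions using (Bijective)
open import Level using (0ℓ)
open import Relation.Binary.PropositionalEquality.Core using (_≡_)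
open import Relation.Unary using (Pred; _∈_; _∪_; ∅; _≐_; ｛_｝)

-- Computability is given by the μ-recursive functions, with a big-step
-- semantics: c [ xs ]↓ y means that c halts on xs with output y.

data Code : ℕ → Set where
  zeroᶜ : ∀ {n} → Code n
  sucᶜ  : Code 1
  projᶜ : ∀ {n} → Fin n → Code n
  compᶜ : ∀ {m n} → Code m → Vec (Code n) m → Code n
  precᶜ : ∀ {n} → Code n → Code (suc (suc n)) → Code (suc n)
  muᶜ   : ∀ {n} → Code (suc n) → Code n

infix 4 _[_]↓_

data _[_]↓_ : ∀ {n} → Code n → Vec ℕ n → ℕ → Set where
  zero↓  : ∀ {n} {xs : Vec ℕ n} → zeroᶜ [ xs ]↓ 0
  suc↓   : ∀ {x} → sucᶜ [ x ∷ [] ]↓ suc x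
  proj↓  : ∀ {n} {xs : Vec ℕ n} (j : Fin n) → projᶜ j [ xs ]↓ lookup xs j
  comp↓  : ∀ {m n} {f : Code m} {gs : Vec (Code n) m} {xs : Vec ℕ n} {ys z} →
           Pointwise (λ g y → g [ xs ]↓ y) gs ys →
           f [ ys ]↓ z →
           compᶜ f gs [ xs ]↓ z
  prec↓₀ : ∀ {n} {f : Code n} {g} {xs : Vec ℕ n} {z} →
           f [ xs ]↓ z →
           precᶜ f g [ 0 ∷ xs ]↓ z
  prec↓₊ : ∀ {n} {f : Code n} {g} {xs : Vec ℕ n} {k y z} →
           precᶜ f g [ k ∷ xs ]↓ y →
           g [ k ∷ y ∷ xs ]↓ z →
           precᶜ f g [ suc k ∷ xs ]↓ z
  mu↓    : ∀ {n} {f : Code (suc n)} {xs : Vec ℕ n} {k} →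
           f [ k ∷ xs ]↓ 0 →
           (∀ j → j < k → ∃[ w ] f [ j ∷ xs ]↓ suc w) →
           muᶜ f [ xs ]↓ k

Computable : ∀ {n} → (Vec ℕ n → ℕ) → Set
Computable {n} f = ∃[ c ] (∀ xs → c [ xs ]↓ f xs)

-- A c.e. set is the domain of a partial computable function.

CE : Pred ℕ 0ℓ → Set
CE A = ∃[ c ] A ≐ (λ a → ∃[ z ] c [ a ∷ [] ]↓ z)

Infinite : Pred ℕ 0ℓ → Set
Infinite A = ∀ k → ∃[ a ] a ∈ A × k ≤ a

record Pairing : Set where
  field
    pair       : ℕ → ℕ → ℕ
    computable : Computable {2} (pair $ⁿ_)
    bijective  : Bijective _≡_ _≡_ (uncurry pair)
    ≤-pairˡ    : ∀ x y → x ≤ pair x y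
    ≤-pairʳ    : ∀ x y → y ≤ pair x y

  tuple : ∀ {n} → Vec ℕ (suc n) → ℕ
  tuple (x ∷ [])     = x
  tuple (x ∷ y ∷ ys) = pair x (tuple (y ∷ ys))

-- A partial function is a single-valued graph.  The partial value of q at x
-- is the predicate val q x, which holds of at most one number, and of none
-- when q is undefined at x; equality of partial values is therefore _≐_.

record PFun (n : ℕ) : Set₁ where
  field
    val        : Vec ℕ n → Pred ℕ 0ℓ
    functional : ∀ {x z z′} → z ∈ val x → z′ ∈ val x → z ≡ z′

open PFun public

infix 4 _≃_

_≃_ : ∀ {n} → PFun n → PFun n → Set
q ≃ r = ∀ x → val q x ≐ val r x

dom : ∀ {n} → PFun n → Pred (Vec ℕ n) 0ℓ
dom q x = ∃[ z ] z ∈ val q x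

𝓡 : ∀ n → Pred (PFun n) 0ℓ
𝓡 n q = ∃[ f ] Computable f × (∀ x → val q x ≐ ｛ f x ｝)

Anf : Pred ℕ 0ℓ → ∀ n → Pred (PFun n) 0ℓ
Anf A n = (λ q → dom q ≐ ∅) ∪ (λ q → ∃[ a ] a ∈ A × dom q ≐ All (_< a))

𝓢 : Pred ℕ 0ℓ → ∀ n → Pred (PFun n) 0ℓ
𝓢 A n = 𝓡 n ∪ Anf A n

record IsNumbering {n} (X : Pred (PFun n) 0ℓ) (θ : ℕ → PFun n) : Set₁ where
  field
    member     : ∀ i → θ i ∈ X
    surjective : ∀ q → q ∈ X → ∃[ i ] θ i ≃ q

-- The partial function (i , x) ↦ θ i x.

universal : ∀ {n} → (ℕ → PFun n) → PFun (suc n)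
universal θ .val        v = val (θ (head v)) (tail v)
universal θ .functional   = functional (θ _)

range : (ℕ → ℕ) → Pred ℕ 0ℓ
range f w = ∃[ t ] f t ≡ w

module _ (P : Pairing) where
  open Pairing P

  ExtGraph : ∀ {n} → PFun (suc n) → Pred ℕ 0ℓ
  ExtGraph {n} q = (λ w → ∃ λ (y : Vec ℕ (suc n)) → w ≡ pair (tuple y) 0)
                 ∪ (λ w → ∃[ x ] ∃[ z ] z ∈ val q x × w ≡ pair (tuple x) (suc z))

  QGN-I : ∀ {n} → (ℕ → PFun (suc n)) → Set
  QGN-I θ = ∃[ e ] Computable {1} (e $ⁿ_) × ExtGraph (universal θ) ≐ range e

  QGN-II : ∀ {n} → Pred ℕ 0ℓ → (ℕ → PFun (suc n)) → Set₁
  QGN-II {n} A θ =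
    ∀ (k : ℕ → ℕ → ℕ) → Computable {2} (k $ⁿ_) →
    ∃[ v ] Computable {1} (v $ⁿ_) ×
      (∀ i (r : PFun (suc n)) → r ∈ 𝓢 A (suc n) →
         range (k i) ≐ ExtGraph r → r ≃ θ (v i))

{-# OPTIONS --safe #-}

-- Fix an enumeration e of the extended graph of (i , V) ↦ θₘ₊ₙ i V.  For the
-- code j of (i , y), replace each enumerated point ⟨⟨i′ , y′ , x⟩ , c⟩ by
-- ⟨⟨x⟩ , c⟩ if ⟨i′ , y′⟩ = j and by the harmless ⟨⟨x⟩ , 0⟩ otherwise.  This
-- enumerates the extended graph of x ↦ θₘ₊ₙ i (y , x) computably in j, and a
-- section of a member of 𝓢 A is again in 𝓢 A, so QGN-II yields an index v j.

module Submission where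

open import Defs
open import Data.Fin.Base using (Fin; zero; suc; _↑ˡ_; _↑ʳ_)
open import Data.Nat.Base using (ℕ; zero; suc; pred; _+_; _∸_; _<_; _≤_; s≤s)
open import Data.Nat.Properties
  using (≤-antisym; ≤-refl; m∸n≡0⇒m≤n; m≤n⇒m∸n≡0; m+n≡0⇒m≡0;
         m+n≡0⇒n≡0; pred[m∸n]≡m∸[1+n]; m<1+n⇒m<n∨m≡n; <-irrefl; _<?_)
open import Data.Product.Base using (∃-syntax; _×_; _,_; proj₁; proj₂)
open import Data.Product.Properties using (,-injectiveˡ; ,-injectiveʳ)
open import Data.Sum.Base using (inj₁; inj₂)
open import Data.Vec.Base
  using (Vec; []; _∷_; [_]; _++_; head; tail; lookup; tabulate; take; drop)
open import Data.Vec.N-ary using (_$ⁿ_)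
open import Data.Vec.Properties
  using (lookup∘tabulate; lookup-++ˡ; lookup-++ʳ; take++drop≡id; ++-injectiveˡ; ++-injectiveʳ)
open import Data.Vec.Relation.Binary.Pointwise.Extensional using (ext; extensional⇒inductive)
open import Data.Vec.Relation.Unary.All using (all?)
open import Data.Vec.Relation.Unary.All.Properties using (++⁺; ++ˡ⁻; ++ʳ⁻)
open import Function.Base using (_∘_)
open import Level using (0ℓ)
open import Relation.Binary.PropositionalEquality
  using (_≡_; _≢_; refl; sym; trans; cong; cong₂; subst)
open import Relation.Nullary using (yes; no; contradiction)
open import Relation.Unary using (Pred; _∈_; _≐_)

-- Closure properties of computable functions

-- A record, so that F can be inferred from Computableᵛ F.
record Computableᵛ {n m} (F : Vec ℕ n → Vec ℕ m) : Set where
  constructor componentwise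
  field
    component : ∀ i → Computable (λ xs → lookup (F xs) i)

open Computableᵛ

-- Many functions agree only after the argument vector has been split into its entries. Pointwise
-- equality suffices, because a code is judged by its outputs alone.
computable-resp : ∀ {n} {f g : Vec ℕ n → ℕ} → (∀ xs → f xs ≡ g xs) → Computable f → Computable g
computable-resp eq (c , h) = c , λ xs → subst (c [ xs ]↓_) (eq xs) (h xs)

[]ᶜ : ∀ {n} → Computableᵛ {n} (λ _ → [])
[]ᶜ .component ()

infixr 5 _∷ᶜ_

_∷ᶜ_ : ∀ {n m} {f : Vec ℕ n → ℕ} {F : Vec ℕ n → Vec ℕ m} →
       Computable f → Computableᵛ F → Computableᵛ (λ xs → f xs ∷ F xs)
(f ∷ᶜ F) .component zero    = f
(f ∷ᶜ F) .component (suc i) = component F i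

id-computable : ∀ {n} → Computableᵛ {n} (λ xs → xs)
id-computable .component i = projᶜ i , λ _ → proj↓ i

lookup-computable : ∀ {n} (i : Fin n) → Computable (λ xs → lookup xs i)
lookup-computable = component id-computable

comp-computable : ∀ {n m} {f : Vec ℕ m → ℕ} {F : Vec ℕ n → Vec ℕ m} →
                  Computable f → Computableᵛ F → Computable (λ xs → f (F xs))
comp-computable {F = F} (c , h) (componentwise G) =
  compᶜ c (tabulate (proj₁ ∘ G)) ,
  λ xs → comp↓ (extensional⇒inductive (ext λ i →
           subst (_[ xs ]↓ lookup (F xs) i) (sym (lookup∘tabulate (proj₁ ∘ G) i)) (proj₂ (G i) xs)))
         (h (F xs))

compᵛ-computable : ∀ {n m l} {F : Vec ℕ m → Vec ℕ l} {G : Vec ℕ n → Vec ℕ m} →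
                   Computableᵛ F → Computableᵛ G → Computableᵛ (λ xs → F (G xs))
compᵛ-computable F G .component i = comp-computable (component F i) G

suc-computable : ∀ {n} {f : Vec ℕ n → ℕ} → Computable f → Computable (λ xs → suc (f xs))
suc-computable f = comp-computable {f = λ v → suc (head v)} (sucᶜ , λ { (x ∷ []) → suc↓ }) (f ∷ᶜ []ᶜ)

const-computable : ∀ {n} c → Computable {n} (λ _ → c)
const-computable zero    = zeroᶜ , λ _ → zero↓
const-computable (suc c) = suc-computable (const-computable c)

-- Taking `φ` along with its recursion equations allows any existing definition of `φ` to be
-- certified, without first rewriting it through a recursor.
prec-computable : ∀ {n} {f : Vec ℕ n → ℕ} {g : Vec ℕ (suc (suc n)) → ℕ} →
                  Computable f → Computable g → (φ : ℕ → Vec ℕ n → ℕ) →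
                  (∀ xs → f xs ≡ φ 0 xs) → (∀ k xs → g (k ∷ φ k xs ∷ xs) ≡ φ (suc k) xs) →
                  Computable (λ v → φ (head v) (tail v))
prec-computable (c , hc) (d , hd) φ φ-zero φ-suc = precᶜ c d , λ { (k ∷ xs) → eval k xs }
  where
  eval : ∀ k xs → precᶜ c d [ k ∷ xs ]↓ φ k xs
  eval zero    xs = prec↓₀ (subst (c [ xs ]↓_) (φ-zero xs) (hc xs))
  eval (suc k) xs = prec↓₊ (eval k xs) (subst (d [ _ ]↓_) (φ-suc k xs) (hd _))

-- The value `φ xs` is known beforehand, so termination of the search is no issue: `root` and
-- `least` identify it as the first zero of the total function `g`.
mu-computable : ∀ {n} {g : Vec ℕ (suc n) → ℕ} → Computable g → (φ : Vec ℕ n → ℕ) →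
                (∀ xs → g (φ xs ∷ xs) ≡ 0) → (∀ xs j → j < φ xs → g (j ∷ xs) ≢ 0) →
                Computable φ
mu-computable {g = g} (c , h) φ root least =
  muᶜ c , λ xs → mu↓ (subst (c [ _ ]↓_) (root xs) (h _)) λ j j<φ → positive (h _) (least xs j j<φ)
  where
  positive : ∀ {v y} → c [ v ]↓ y → y ≢ 0 → ∃[ w ] c [ v ]↓ suc w
  positive {y = zero}  _ y≢0 = contradiction refl y≢0
  positive {y = suc w} h _   = w , h

tail-computable : ∀ {n} → Computableᵛ {suc n} tail
tail-computable .component i = computable-resp (λ { (_ ∷ _) → refl }) (lookup-computable (suc i))

take-computable : ∀ m {n} → Computableᵛ (λ (v : Vec ℕ (m + n)) → take m v)
take-computable m {n} .component i = computable-resp eq (lookup-computable (i ↑ˡ n))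
  where
  eq : ∀ (v : Vec ℕ (m + n)) → lookup v (i ↑ˡ n) ≡ lookup (take m v) i
  eq v = trans (cong (λ u → lookup u (i ↑ˡ n)) (sym (take++drop≡id m v)))
               (lookup-++ˡ (take m v) (drop m v) i)

drop-computable : ∀ m {n} → Computableᵛ (λ (v : Vec ℕ (m + n)) → drop m v)
drop-computable m {n} .component i = computable-resp eq (lookup-computable (m ↑ʳ i))
  where
  eq : ∀ (v : Vec ℕ (m + n)) → lookup v (m ↑ʳ i) ≡ lookup (drop m v) i
  eq v = trans (cong (λ u → lookup u (m ↑ʳ i)) (sym (take++drop≡id m v)))
               (lookup-++ʳ (take m v) (drop m v) i)

-- The prefix is fixed, so its entries are built into the codes as constants.
++-computable : ∀ {m n} (ys : Vec ℕ m) → Computableᵛ (λ (xs : Vec ℕ n) → ys ++ xs)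
++-computable []       = id-computable
++-computable (y ∷ ys) = const-computable y ∷ᶜ ++-computable ys

-- Arithmetic

private
  #0 : ∀ {n} → Computable {suc n} (λ xs → lookup xs zero)
  #0 = lookup-computable zero

  #1 : ∀ {n} → Computable {suc (suc n)} (λ xs → lookup xs (suc zero))
  #1 = lookup-computable (suc zero)

  #2 : ∀ {n} → Computable {suc (suc (suc n))} (λ xs → lookup xs (suc (suc zero)))
  #2 = lookup-computable (suc (suc zero))

  #3 : ∀ {n} → Computable {suc (suc (suc (suc n)))} (λ xs → lookup xs (suc (suc (suc zero))))
  #3 = lookup-computable (suc (suc (suc zero)))

module _ {n} {f g : Vec ℕ n → ℕ} (cf : Computable f) (cg : Computable g) where

  +-computable : Computable (λ xs → f xs + g xs)
  +-computable = comp-computable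
    (prec-computable #0 (suc-computable #1) (λ k xs → k + lookup xs zero) (λ _ → refl) (λ _ _ → refl))
    (cf ∷ᶜ cg ∷ᶜ []ᶜ)

  ∸-computable : Computable (λ xs → f xs ∸ g xs)
  -- The recursion runs on the subtrahend, so `cg` comes before `cf`.
  ∸-computable = comp-computable
    (prec-computable #0 (pred-computable #1) (λ k xs → lookup xs zero ∸ k) (λ _ → refl)
      (λ k xs → pred[m∸n]≡m∸[1+n] (lookup xs zero) k))
    (cg ∷ᶜ cf ∷ᶜ []ᶜ)
    where
    pred-computable : ∀ {n} {f : Vec ℕ n → ℕ} → Computable f → Computable (λ xs → pred (f xs))
    pred-computable f = comp-computable
      (prec-computable (const-computable 0) #0 (λ k _ → pred k) (λ _ → refl) (λ _ _ → refl))
      (f ∷ᶜ []ᶜ)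

-- The absolute difference, which turns equality into a test for zero, as `ifZero` and minimisation
-- require.
dist : ℕ → ℕ → ℕ
dist a b = (a ∸ b) + (b ∸ a)

dist-refl : ∀ a → dist a a ≡ 0
dist-refl a = cong₂ _+_ (m≤n⇒m∸n≡0 (≤-refl {a})) (m≤n⇒m∸n≡0 (≤-refl {a}))

dist≡0⇒≡ : ∀ {a b} → dist a b ≡ 0 → a ≡ b
dist≡0⇒≡ {a} {b} eq = ≤-antisym (m∸n≡0⇒m≤n (m+n≡0⇒m≡0 (a ∸ b) eq)) (m∸n≡0⇒m≤n (m+n≡0⇒n≡0 (a ∸ b) eq))

dist-computable : ∀ {n} {f g : Vec ℕ n → ℕ} → Computable f → Computable g →
                  Computable (λ xs → dist (f xs) (g xs))
dist-computable f g = +-computable (∸-computable f g) (∸-computable g f)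

ifZero : ℕ → ℕ → ℕ → ℕ
ifZero zero    a b = a
ifZero (suc _) a b = b

ifZero-same : ∀ d a → ifZero d a a ≡ a
ifZero-same zero    a = refl
ifZero-same (suc d) a = refl

ifZero-computable : ∀ {n} {d f g : Vec ℕ n → ℕ} → Computable d → Computable f → Computable g →
                    Computable (λ xs → ifZero (d xs) (f xs) (g xs))
ifZero-computable d f g = comp-computable
  -- A recursion step that ignores the counter and the previous value acts as a case distinction.
  (prec-computable #0 #3 (λ k xs → ifZero k (lookup xs zero) (lookup xs (suc zero)))
    (λ _ → refl) (λ _ _ → refl))
  (d ∷ᶜ f ∷ᶜ g ∷ᶜ []ᶜ)

-- Coding of tuples

module Coding (P : Pairing) where
  open Pairing P

  pair-computable : ∀ {n} {f g : Vec ℕ n → ℕ} → Computable f → Computable g →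
                    Computable (λ xs → pair (f xs) (g xs))
  pair-computable f g = comp-computable computable (f ∷ᶜ g ∷ᶜ []ᶜ)

  pair-injective : ∀ {x y x′ y′} → pair x y ≡ pair x′ y′ → (x , y) ≡ (x′ , y′)
  pair-injective = proj₁ bijective

  -- Read off from the surjectivity of `pair`, which supplies no code; computability is obtained
  -- below by search.
  left right : ℕ → ℕ
  left  w = proj₁ (proj₁ (proj₂ bijective w))
  right w = proj₂ (proj₁ (proj₂ bijective w))

  pair-left-right : ∀ w → pair (left w) (right w) ≡ w
  pair-left-right w = proj₂ (proj₂ bijective w) refl

  left-pair : ∀ x y → left (pair x y) ≡ x
  left-pair x y = ,-injectiveˡ (pair-injective (pair-left-right (pair x y)))

  right-pair : ∀ x y → right (pair x y) ≡ y
  right-pair x y = ,-injectiveʳ (pair-injective (pair-left-right (pair x y)))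

  -- misses k x w vanishes iff w = pair x y for some y < k.
  misses : ℕ → ℕ → ℕ → ℕ
  misses zero    x w = 1
  misses (suc k) x w = ifZero (dist (pair x k) w) 0 (misses k x w)

  misses-hit : ∀ {k x y} → y < k → misses k x (pair x y) ≡ 0
  misses-hit {suc k} {x} {y} y<1+k with m<1+n⇒m<n∨m≡n y<1+k
  ... | inj₂ refl = cong (λ d → ifZero d 0 (misses k x (pair x k))) (dist-refl (pair x k))
  ... | inj₁ y<k  = trans (cong (ifZero (dist (pair x k) (pair x y)) 0) (misses-hit y<k))
                          (ifZero-same (dist (pair x k) (pair x y)) 0)

  misses≡0⇒left : ∀ k {x w} → misses k x w ≡ 0 → left w ≡ x
  misses≡0⇒left (suc k) {x} {w} eq with dist (pair x k) w in d≡
  ... | zero  = trans (cong left (sym (dist≡0⇒≡ d≡))) (left-pair x k)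
  ... | suc _ = misses≡0⇒left k eq

  misses-computable : Computable {3} (misses $ⁿ_)
  misses-computable = computable-resp (λ { (_ ∷ _ ∷ _ ∷ []) → refl }) (prec-computable
    (const-computable 1)
    (ifZero-computable (dist-computable (pair-computable #2 #0) #3) (const-computable 0) #1)
    (λ k v → misses k (lookup v zero) (lookup v (suc zero))) (λ _ → refl) (λ _ _ → refl))

  -- Minimise over the first coordinate. Since `y ≤ pair x y`, a matching second coordinate is below
  -- `suc w`, so the inner search is bounded and the test is total.
  left-computable : ∀ {n} {f : Vec ℕ n → ℕ} → Computable f → Computable (λ xs → left (f xs))
  left-computable f = comp-computable (mu-computable
      (comp-computable misses-computable (suc-computable #1 ∷ᶜ #0 ∷ᶜ #1 ∷ᶜ []ᶜ))
      (left ∘ head)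
      (λ { (w ∷ []) → subst (λ u → misses (suc w) (left w) u ≡ 0) (pair-left-right w)
                        (misses-hit (s≤s (subst (right w ≤_) (pair-left-right w)
                                                (≤-pairʳ (left w) (right w))))) })
      (λ { (w ∷ []) j j<l eq → <-irrefl (sym (misses≡0⇒left (suc w) eq)) j<l }))
    (f ∷ᶜ []ᶜ)

  -- Once `left w` is computable, the second coordinate is the only `y` with `pair (left w) y ≡ w`,
  -- and minimisation finds it.
  right-computable : ∀ {n} {f : Vec ℕ n → ℕ} → Computable f → Computable (λ xs → right (f xs))
  right-computable f = comp-computable (mu-computable
      (dist-computable (pair-computable (left-computable #1) #0) #1)
      (right ∘ head)
      (λ { (w ∷ []) → trans (cong (λ u → dist u w) (pair-left-right w)) (dist-refl w) })
      (λ { (w ∷ []) j j<r eq →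
             <-irrefl (sym (trans (cong right (sym (dist≡0⇒≡ eq))) (right-pair (left w) j))) j<r }))
    (f ∷ᶜ []ᶜ)

  tuple-computable : ∀ {n m} {F : Vec ℕ n → Vec ℕ (suc m)} →
                     Computableᵛ F → Computable (λ xs → tuple (F xs))
  tuple-computable {m = m} F = comp-computable (tuple-computable′ m) F
    where
    tuple-computable′ : ∀ m → Computable (tuple {m})
    tuple-computable′ zero    = computable-resp (λ { (_ ∷ []) → refl }) #0
    tuple-computable′ (suc m) = computable-resp (λ { (_ ∷ _ ∷ _) → refl })
      (pair-computable #0 (comp-computable (tuple-computable′ m) tail-computable))

  untuple : ∀ n → ℕ → Vec ℕ (suc n)
  untuple zero    w = [ w ]
  untuple (suc n) w = left w ∷ untuple n (right w)

  untuple-tuple : ∀ {n} (xs : Vec ℕ (suc n)) → untuple n (tuple xs) ≡ xs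
  untuple-tuple (x ∷ [])     = refl
  untuple-tuple (x ∷ y ∷ ys) = cong₂ _∷_ (left-pair x (tuple (y ∷ ys)))
    (trans (cong (untuple _) (right-pair x (tuple (y ∷ ys)))) (untuple-tuple (y ∷ ys)))

  tuple-injective : ∀ {n} {xs ys : Vec ℕ (suc n)} → tuple xs ≡ tuple ys → xs ≡ ys
  tuple-injective {n} {xs} {ys} eq =
    trans (sym (untuple-tuple xs)) (trans (cong (untuple n) eq) (untuple-tuple ys))

  untuple-computable : ∀ {n} m {f : Vec ℕ n → ℕ} → Computable f → Computableᵛ (λ xs → untuple m (f xs))
  untuple-computable zero    f = f ∷ᶜ []ᶜ
  untuple-computable (suc m) f = left-computable f ∷ᶜ untuple-computable m (right-computable f)

-- Sections of partial functions

section : ∀ {m n} → PFun (m + n) → Vec ℕ m → PFun n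
section q y .val        x = val q (y ++ x)
section q y .functional   = functional q

-- The cube of side `a` meets the fibre over `y` in a cube of the same side if all entries of `y`
-- are below `a`, and in nothing otherwise.
section-∈-𝓢 : ∀ {A : Pred ℕ 0ℓ} {m n} (q : PFun (m + n)) (y : Vec ℕ m) →
              q ∈ 𝓢 A (m + n) → section q y ∈ 𝓢 A n
section-∈-𝓢 q y (inj₁ (f , cf , q≐f)) =
  inj₁ (f ∘ (y ++_) , comp-computable cf (++-computable y) , λ x → q≐f (y ++ x))
section-∈-𝓢 q y (inj₂ (inj₁ (q⊆∅ , _))) = inj₂ (inj₁ (q⊆∅ , λ ()))
section-∈-𝓢 q y (inj₂ (inj₂ (a , a∈A , dom⊆ , dom⊇))) with all? (_<? a) y
... | yes y<a = inj₂ (inj₂ (a , a∈A , (λ d → ++ʳ⁻ y (dom⊆ d)) , λ x<a → dom⊇ (++⁺ y<a x<a)))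
... | no  y≮a = inj₂ (inj₁ ((λ d → y≮a (++ˡ⁻ y (dom⊆ d))) , λ ()))

-- Enumerating the extended graph of a section

module Restriction (P : Pairing) (l n : ℕ) where
  open Pairing P
  open Coding P

  -- The default 0 is safe because every extended graph contains all points with second coordinate
  -- 0.
  restrict : ℕ → ℕ → ℕ
  restrict j w = pair (tuple (drop (suc l) V)) (ifZero (dist (tuple (take (suc l) V)) j) (right w) 0)
    where
    V : Vec ℕ (suc l + suc n)
    V = untuple (l + suc n) (left w)

  restrict-computable : ∀ {k} {f g : Vec ℕ k → ℕ} → Computable f → Computable g →
                        Computable (λ xs → restrict (f xs) (g xs))
  restrict-computable cf cg = pair-computable
    (tuple-computable (compᵛ-computable (drop-computable (suc l)) V))
    (ifZero-computable
      (dist-computable (tuple-computable (compᵛ-computable (take-computable (suc l)) V)) cf)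
      (right-computable cg) (const-computable 0))
    where V = untuple-computable (l + suc n) (left-computable cg)

  restrict-pair : ∀ j (I : Vec ℕ (suc l)) (x : Vec ℕ (suc n)) c →
                  restrict j (pair (tuple (I ++ x)) c) ≡ pair (tuple x) (ifZero (dist (tuple I) j) c 0)
  restrict-pair j I x c
    -- Injectivity of `_++_` shows that `take` and `drop` recover `I` and `x`.
    rewrite left-pair (tuple (I ++ x)) c | right-pair (tuple (I ++ x)) c | untuple-tuple (I ++ x)
          | ++-injectiveˡ (take (suc l) (I ++ x)) I (take++drop≡id (suc l) (I ++ x))
          | ++-injectiveʳ (take (suc l) (I ++ x)) I (take++drop≡id (suc l) (I ++ x)) = refl

  restrict-match : ∀ I (x : Vec ℕ (suc n)) c →
                   restrict (tuple I) (pair (tuple (I ++ x)) c) ≡ pair (tuple x) c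
  restrict-match I x c = trans (restrict-pair (tuple I) I x c)
    (cong (λ d → pair (tuple x) (ifZero d c 0)) (dist-refl (tuple I)))

  -- Each point of the section over `x` comes from the point of `q` over `I ++ x`; conversely, every
  -- enumerated point, matching or not, lands in the target.
  range-restrict : ∀ {e} (q : PFun (suc l + suc n)) I → ExtGraph P q ≐ range e →
                   range (restrict (tuple I) ∘ e) ≐ ExtGraph P (section q I)
  range-restrict {e} q I (graph⊆ , graph⊇) =
    (λ { (t , refl) → sound (e t) (graph⊇ (t , refl)) }) , complete
    where
    hit : ∀ {w u} → w ∈ ExtGraph P q → restrict (tuple I) w ≡ u → u ∈ range (restrict (tuple I) ∘ e)
    hit w∈ eq with graph⊆ w∈
    ... | t , refl = t , eq

    complete : ∀ {u} → u ∈ ExtGraph P (section q I) → u ∈ range (restrict (tuple I) ∘ e)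
    complete (inj₁ (x , refl))          = hit (inj₁ (I ++ x , refl)) (restrict-match I x 0)
    complete (inj₂ (x , z , z∈ , refl)) = hit (inj₂ (I ++ x , z , z∈ , refl)) (restrict-match I x (suc z))

    sound : ∀ w → w ∈ ExtGraph P q → restrict (tuple I) w ∈ ExtGraph P (section q I)
    -- Here the second coordinate is already 0, so both branches of `ifZero` agree.
    sound _ (inj₁ (V , refl)) rewrite sym (take++drop≡id (suc l) V) =
      inj₁ (x , trans (restrict-pair (tuple I) J x 0)
                      (cong (pair (tuple x)) (ifZero-same (dist (tuple J) (tuple I)) 0)))
      where
      J = take (suc l) V
      x = drop (suc l) V
    sound _ (inj₂ (V , z , z∈ , refl)) rewrite sym (take++drop≡id (suc l) V) = go refl
      where
      J = take (suc l) V
      x = drop (suc l) V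
      -- Distance zero forces `J ≡ I`, and the value is transported to the section; a positive
      -- distance yields a point with second coordinate 0.
      go : ∀ {d} → dist (tuple J) (tuple I) ≡ d →
           restrict (tuple I) (pair (tuple (J ++ x)) (suc z)) ∈ ExtGraph P (section q I)
      go {zero}  d≡ = inj₂ (x , z , subst (λ K → z ∈ val q (K ++ x)) (tuple-injective (dist≡0⇒≡ d≡)) z∈ ,
        trans (restrict-pair (tuple I) J x (suc z)) (cong (λ d → pair (tuple x) (ifZero d (suc z) 0)) d≡))
      go {suc _} d≡ = inj₁ (x ,
        trans (restrict-pair (tuple I) J x (suc z)) (cong (λ d → pair (tuple x) (ifZero d (suc z) 0)) d≡))

theorem4p5 : ∀ (P : Pairing) (A : Pred ℕ 0ℓ) → Infinite A → CE A →
    ∀ (m n : ℕ)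
    (θₙ : ℕ → PFun (suc n)) → IsNumbering (𝓢 A (suc n)) θₙ → QGN-II P A θₙ →
    ∀ (θₘ₊ₙ : ℕ → PFun (suc m + suc n)) → IsNumbering (𝓢 A (suc m + suc n)) θₘ₊ₙ → QGN-I P θₘ₊ₙ →
    ∃[ s ] Computable {suc (suc m)} s ×
    (∀ (i : ℕ) (y : Vec ℕ (suc m)) (x : Vec ℕ (suc n)) →
    val (θₙ (s (i ∷ y))) x ≐ val (θₘ₊ₙ i) (y ++ x))
theorem4p5 P A _ _ m n θₙ _ qgn-II θₘ₊ₙ num (e , ce , graph≐) =
  (λ I → v (tuple I)) ,
  comp-computable (proj₁ (proj₂ index)) (tuple-computable id-computable ∷ᶜ []ᶜ) ,
  λ i y x →
    -- By computation, `section (universal θₘ₊ₙ) (i ∷ y)` and `section (θₘ₊ₙ i) y` have the same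
    -- `val`, hence the same extended graph.
    let eq = proj₂ (proj₂ index) (tuple (i ∷ y)) (section (θₘ₊ₙ i) y)
               (section-∈-𝓢 (θₘ₊ₙ i) y (IsNumbering.member num i))
               (range-restrict (universal θₘ₊ₙ) (i ∷ y) graph≐) x
    in proj₂ eq , proj₁ eq
  where
  open Pairing P
  open Coding P
  -- The prefix consists of `i` and the `suc m` entries of `y`, so its length is `suc (suc m)`.
  open Restriction P (suc m) n

  k : ℕ → ℕ → ℕ
  k j t = restrict j (e t)

  k-computable : Computable {2} (k $ⁿ_)
  k-computable = computable-resp (λ { (_ ∷ _ ∷ []) → refl })
    (restrict-computable #0 (comp-computable ce (#1 ∷ᶜ []ᶜ)))

  index = qgn-II k k-computable

  v : ℕ → ℕ
  v = proj₁ index
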